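{- Let $\Delta$ be a positive integer and let $f\colon\mathbb{N}\to\mathbb{R}$ be a superlinear function with $f(r)\geq \Delta r+1$ for all $r\in\mathbb{N}$. Then every finite graph $G$ with maximum degree $\Delta$ has a uniform subdivision $\tilde G$ with growth $f_{\tilde G}(r)\leq f(r)$ for every positive integer $r$.
   Context: $\mathbb{N}$ is the set of positive integers. A function $f\colon\mathbb{N}\to\mathbb{R}$ is superlinear if $f(x)/x\to\infty$ as $x\to\infty$. The growth of a finite graph $G$ is the function $f_G\colon\mathbb{N}\to\mathbb{N}$ where $f_G(r)$ is the maximum of $|V(H)|$ over all subgraphs $H$ of $G$ of radius at most $r$. A subdivision of $G$ is a graph obtained by replacing each edge $vw$ by a path $P_{vw}$ with endpoints $v$ and $w$, internally disjoint from the rest of the graph; it is uniform if all the paths $P_{vw}$ have the same length. -}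

module Defs where

open import Data.Fin.Base as Fin using (Fin; zero; suc; inject₁; fromℕ)
open import Data.Fin.Properties using (any?; all?)
import Data.Fin.Properties as Fin
open import Data.Fin.Subset using (Subset; _∈_; _∉_; ∣_∣; inside; outside)
open import Data.Fin.Subset.Properties using (_∈?_)
open import Data.Integer.Base using (+_)
open import Data.List.Base as List using (List; []; _∷_; allFin; cartesianProduct; cartesianProductWith)
open import Data.List.Extrema.Nat using (max; xs≤max; argmax-sel)
open import Data.List.Membership.Propositional using () renaming (_∈_ to _∈ˡ_)
open import Data.List.Membership.Propositional.Properties
  using (∈-cartesianProductWith⁺; ∈-cartesianProduct⁺; ∈-filter⁺; ∈-filter⁻; ∈-map⁺; ∈-map⁻)
import Data.List.Relation.Unary.All as All
open import Data.List.Relation.Unary.Any using (here; there)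
open import Data.Nat.Base as ℕ using (ℕ; zero; suc; NonZero)
import Data.Nat.Properties as ℕ
open import Data.Product.Base using (Σ; ∃; ∃₂; _×_; _,_; proj₁; proj₂)
open import Data.Rational.Base as ℚ using (ℚ; Positive)
import Data.Rational.Properties as ℚ
open import Data.Sum.Base using (_⊎_; inj₁; inj₂; map₂)
open import Data.Vec.Base using (Vec; []; _∷_; lookup)
open import Function.Base using (id)
open import Relation.Binary.Definitions using (tri<; tri≈; tri>)
open import Relation.Binary.PropositionalEquality using (_≡_; _≢_; refl; sym; trans; cong; subst)
open import Relation.Nullary.Decidable using (Dec; map′; _×-dec_; _→-dec_)
open import Relation.Nullary.Negation using (¬_)

-- Two-sided located Dedekind cuts of ℚ.
record ℝ : Set₁ where
  field
    lower upper     : ℚ → Set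
    lower-inhabited : ∃ lower
    upper-inhabited : ∃ upper
    lower-closed    : ∀ {p q} → p ℚ.< q → lower q → lower p
    upper-closed    : ∀ {p q} → p ℚ.< q → upper p → upper q
    lower-open      : ∀ {p} → lower p → ∃ λ q → p ℚ.< q × lower q
    upper-open      : ∀ {q} → upper q → ∃ λ p → p ℚ.< q × upper p
    disjoint        : ∀ {q} → lower q → ¬ upper q
    located         : ∀ {p q} → p ℚ.< q → lower p ⊎ upper q

open ℝ

infix 4 _≤_

_≤_ : ℝ → ℝ → Set
x ≤ y = ∀ {q} → lower x q → lower y q

fromℚ : ℚ → ℝ
fromℚ c = record
  { lower           = ℚ._< c
  ; upper           = c ℚ.<_
  ; lower-inhabited = c ℚ.- ℚ.1ℚ , subst (c ℚ.- ℚ.1ℚ ℚ.<_) (ℚ.+-identityʳ c) (ℚ.+-monoʳ-< c (ℚ.negative⁻¹ (ℚ.- ℚ.1ℚ)))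
  ; upper-inhabited = c ℚ.+ ℚ.1ℚ , subst (ℚ._< c ℚ.+ ℚ.1ℚ) (ℚ.+-identityʳ c) (ℚ.+-monoʳ-< c (ℚ.positive⁻¹ ℚ.1ℚ))
  ; lower-closed    = ℚ.<-trans
  ; upper-closed    = λ p<q c<p → ℚ.<-trans c<p p<q
  ; lower-open      = ℚ.<-dense
  ; upper-open      = λ c<q → let m , c<m , m<q = ℚ.<-dense c<q in m , m<q , c<m
  ; disjoint        = ℚ.<-asym
  ; located         = loc
  }
  where
  loc : ∀ {p q} → p ℚ.< q → p ℚ.< c ⊎ c ℚ.< q
  loc {p} p<q with ℚ.<-cmp p c
  ... | tri< p<c _ _    = inj₁ p<c
  ... | tri≈ _ refl _   = inj₂ p<q
  ... | tri> _ _ c<p    = inj₂ (ℚ.<-trans c<p p<q)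

ℕ→ℚ : ℕ → ℚ
ℕ→ℚ n = + n ℚ./ 1

ℕ→ℝ : ℕ → ℝ
ℕ→ℝ n = fromℚ (ℕ→ℚ n)

infixl 7 _÷_

-- q < x / c  iff  q * c < x,  as c is positive.
_÷_ : ℝ → (c : ℚ) .{{_ : Positive c}} → ℝ
x ÷ c = record
  { lower           = λ q → lower x (q ℚ.* c)
  ; upper           = λ q → upper x (q ℚ.* c)
  ; lower-inhabited = let p , lp = lower-inhabited x in p ℚ.* 1/c , subst (lower x) (sym (cancel p)) lp
  ; upper-inhabited = let p , up = upper-inhabited x in p ℚ.* 1/c , subst (upper x) (sym (cancel p)) up
  ; lower-closed    = λ p<q → lower-closed x (ℚ.*-monoˡ-<-pos c p<q)
  ; upper-closed    = λ p<q → upper-closed x (ℚ.*-monoˡ-<-pos c p<q)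
  ; lower-open      = λ {p} lp → let q , pc<q , lq = lower-open x lp in
      q ℚ.* 1/c , cancel-< (subst (p ℚ.* c ℚ.<_) (sym (cancel q)) pc<q) , subst (lower x) (sym (cancel q)) lq
  ; upper-open      = λ {q} uq → let p , p<qc , up = upper-open x uq in
      p ℚ.* 1/c , cancel-< (subst (ℚ._< q ℚ.* c) (sym (cancel p)) p<qc) , subst (upper x) (sym (cancel p)) up
  ; disjoint        = disjoint x
  ; located         = λ p<q → located x (ℚ.*-monoˡ-<-pos c p<q)
  }
  where
  instance
    c≢0 : ℚ.NonZero c
    c≢0 = ℚ.pos⇒nonZero c
    c≥0 : ℚ.NonNegative c
    c≥0 = ℚ.pos⇒nonNeg c
  1/c : ℚ
  1/c = ℚ.1/ c
  cancel : ∀ p → p ℚ.* 1/c ℚ.* c ≡ p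
  cancel p = trans (ℚ.*-assoc p 1/c c) (trans (cong (p ℚ.*_) (ℚ.*-inverseˡ c)) (ℚ.*-identityʳ p))
  cancel-< : ∀ {p q} → p ℚ.* c ℚ.< q ℚ.* c → p ℚ.< q
  cancel-< = ℚ.*-cancelʳ-<-nonNeg c

instance
  ℕ→ℚ-positive : ∀ {n} .{{_ : NonZero n}} → Positive (ℕ→ℚ n)
  ℕ→ℚ-positive {n} = ℚ.normalize-pos n 1

ℕ⁺→ℝ : Set₁
ℕ⁺→ℝ = (n : ℕ) .{{_ : NonZero n}} → ℝ

Superlinear : ℕ⁺→ℝ → Set₁
Superlinear f = ∀ (M : ℝ) → ∃ λ (N : ℕ) →
  ∀ (x : ℕ) .{{_ : NonZero x}} → N ℕ.≤ x → M ≤ f x ÷ ℕ→ℚ x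

record Graph : Set where
  field
    order             : ℕ
    neighbours        : Fin order → Subset order
    neighbours-sym    : ∀ {u v} → v ∈ neighbours u → u ∈ neighbours v
    neighbours-irrefl : ∀ {v} → v ∉ neighbours v

  Vertex : Set
  Vertex = Fin order

  degree : Vertex → ℕ
  degree v = ∣ neighbours v ∣

  -- One representative u < v for each undirected edge.
  Edge : Set
  Edge = ∃₂ λ (u v : Vertex) → u Fin.< v × v ∈ neighbours u

  src tgt : Edge → Vertex
  src (u , _)     = u
  tgt (_ , v , _) = v

open Graph

maxDegree : Graph → ℕ
maxDegree G = max 0 (List.map (degree G) (allFin (order G)))

-- A vertex set and an adjacency matrix, whose v-th row is the neighbourhood
-- of v.  This raw data is kept apart from the property IsSubgraph so that it
-- can be listed exhaustively.
SubgraphData : Graph → Set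
SubgraphData G = Subset (order G) × Vec (Subset (order G)) (order G)

module _ (G : Graph) where

  verts : SubgraphData G → Subset (order G)
  verts = proj₁

  nbrs : SubgraphData G → Vertex G → Subset (order G)
  nbrs H v = lookup (proj₂ H) v

  IsSubgraph : SubgraphData G → Set
  IsSubgraph H = ∀ (u v : Vertex G) → v ∈ nbrs H u →
    u ∈ verts H × v ∈ verts H × v ∈ neighbours G u × u ∈ nbrs H v

  Walk : SubgraphData G → ℕ → Vertex G → Vertex G → Set
  Walk H zero    u v = u ≡ v
  Walk H (suc k) u v = ∃ λ w → w ∈ nbrs H u × Walk H k w v

  Distance≤ : SubgraphData G → ℕ → Vertex G → Vertex G → Set
  Distance≤ H r u v = ∃ λ k → k ℕ.≤ r × Walk H k u v

  -- The radius is the least eccentricity of a vertex, so it is at most r iff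
  -- some vertex has eccentricity at most r.
  Radius≤ : SubgraphData G → ℕ → Set
  Radius≤ H r = ∃ λ c → c ∈ verts H × (∀ v → v ∈ verts H → Distance≤ H r c v)

  isSubgraph? : ∀ H → Dec (IsSubgraph H)
  isSubgraph? H = all? λ u → all? λ v → (v ∈? nbrs H u) →-dec
    ((u ∈? verts H) ×-dec (v ∈? verts H) ×-dec (v ∈? neighbours G u) ×-dec (u ∈? nbrs H v))

  walk? : ∀ H k u v → Dec (Walk H k u v)
  walk? H zero    u v = u Fin.≟ v
  walk? H (suc k) u v = any? λ w → (w ∈? nbrs H u) ×-dec walk? H k w v

  distance≤? : ∀ H r u v → Dec (Distance≤ H r u v)
  distance≤? H r u v =
    map′ (λ (k , k<1+r , p) → k , ℕ.s≤s⁻¹ k<1+r , p) (λ (k , k≤r , p) → k , ℕ.s≤s k≤r , p)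
         (ℕ.anyUpTo? (λ k → walk? H k u v) (suc r))

  radius≤? : ∀ H r → Dec (Radius≤ H r)
  radius≤? H r = any? λ c → (c ∈? verts H) ×-dec
    all? λ v → (v ∈? verts H) →-dec distance≤? H r c v

allVecs : ∀ {A : Set} → List A → ∀ n → List (Vec A n)
allVecs xs zero    = [] ∷ []
allVecs xs (suc n) = cartesianProductWith _∷_ xs (allVecs xs n)

allSubsets : ∀ n → List (Subset n)
allSubsets = allVecs (inside ∷ outside ∷ [])

candidates : (G : Graph) → List (SubgraphData G)
candidates G = cartesianProduct (allSubsets (order G)) (allVecs (allSubsets (order G)) (order G))

subgraphsOfRadius≤ : (G : Graph) → ℕ → List (SubgraphData G)
subgraphsOfRadius≤ G r = List.filter (λ H → isSubgraph? G H ×-dec radius≤? G H r) (candidates G)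

-- The base value 0 only matters for the graph with no vertices.
growth : Graph → ℕ → ℕ
growth G r = max 0 (List.map (λ H → ∣ verts G H ∣) (subgraphsOfRadius≤ G r))

-- The list used in `growth` is exhaustive, so `growth` is indeed the maximum.
∈-allVecs : ∀ {A : Set} (xs : List A) → (∀ a → a ∈ˡ xs) → ∀ {n} (v : Vec A n) → v ∈ˡ allVecs xs n
∈-allVecs xs all []      = here refl
∈-allVecs xs all (a ∷ v) = ∈-cartesianProductWith⁺ _∷_ (all a) (∈-allVecs xs all v)

∈-allSubsets : ∀ {n} (S : Subset n) → S ∈ˡ allSubsets n
∈-allSubsets = ∈-allVecs _ λ where
  inside  → here refl
  outside → there (here refl)

∈-subgraphsOfRadius≤ : ∀ G r H → IsSubgraph G H → Radius≤ G H r → H ∈ˡ subgraphsOfRadius≤ G r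
∈-subgraphsOfRadius≤ G r H sub rad = ∈-filter⁺ (λ H → isSubgraph? G H ×-dec radius≤? G H r)
  (∈-cartesianProduct⁺ (∈-allSubsets (proj₁ H)) (∈-allVecs _ ∈-allSubsets (proj₂ H)))
  (sub , rad)

growth-upperBound : ∀ G r H → IsSubgraph G H → Radius≤ G H r → ∣ verts G H ∣ ℕ.≤ growth G r
growth-upperBound G r H sub rad =
  All.lookup (xs≤max 0 _) (∈-map⁺ (λ H → ∣ verts G H ∣) (∈-subgraphsOfRadius≤ G r H sub rad))

growth-attained : ∀ G r → growth G r ≡ 0 ⊎
  ∃ λ H → IsSubgraph G H × Radius≤ G H r × growth G r ≡ ∣ verts G H ∣
growth-attained G r = map₂ unpack (argmax-sel id 0 (List.map size (subgraphsOfRadius≤ G r)))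
  where
  size : SubgraphData G → ℕ
  size H = ∣ verts G H ∣
  unpack : growth G r ∈ˡ List.map size (subgraphsOfRadius≤ G r) →
           ∃ λ H → IsSubgraph G H × Radius≤ G H r × growth G r ≡ size H
  unpack m with ∈-map⁻ size m
  ... | H , H∈ , eq =
    let _ , sub , rad = ∈-filter⁻ (λ H → isSubgraph? G H ×-dec radius≤? G H r) {xs = candidates G} H∈
    in H , sub , rad , eq

record Path (G : Graph) (a b : Vertex G) : Set where
  field
    length    : ℕ
    at        : Fin (suc length) → Vertex G
    start     : at zero ≡ a
    end       : at (fromℕ length) ≡ b
    adjacent  : ∀ i → at (suc i) ∈ neighbours G (at (inject₁ i))
    injective : ∀ {i j} → at i ≡ at j → i ≡ j

  Interior : Vertex G → Set
  Interior x = ∃ λ i → i ≢ zero × i ≢ fromℕ length × at i ≡ x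

  Traverses : Vertex G → Vertex G → Set
  Traverses x y = ∃ λ i → (at (inject₁ i) ≡ x × at (suc i) ≡ y) ⊎ (at (inject₁ i) ≡ y × at (suc i) ≡ x)

open Path

record Subdivision (G G̃ : Graph) : Set where
  field
    branch           : Vertex G → Vertex G̃
    branch-injective : ∀ {u v} → branch u ≡ branch v → u ≡ v
    path             : (e : Edge G) → Path G̃ (branch (src G e)) (branch (tgt G e))
    interior-branch  : ∀ e {x} → Interior (path e) x → ∀ v → x ≢ branch v
    interior-path    : ∀ e e′ {x} → Interior (path e) x → Interior (path e′) x →
                       src G e ≡ src G e′ × tgt G e ≡ tgt G e′
    vertices-covered : ∀ x → (∃ λ v → x ≡ branch v) ⊎ (∃ λ e → Interior (path e) x)
    edges-covered    : ∀ {x y} → y ∈ neighbours G̃ x → ∃ λ e → Traverses (path e) x y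

  Uniform : Set
  Uniform = ∀ e e′ → length (path e) ≡ length (path e′)

-- Subdivide every edge into a path of ℓ edges.  If 2r < ℓ, a ball of radius r contains at most
-- one vertex of G, so it consists of paths issuing from that vertex and, when Δ ≥ 2, has at most
-- Δ points at each distance 1, …, r from its centre: at most Δr + 1 in all.  If 2r ≥ ℓ, the
-- order of the subdivision is at most (|V| + |E|) ℓ ≤ 2 (|V| + |E|) r, which is at most f(r) for
-- ℓ large, by superlinearity.  When Δ = 1 a ball centred inside a path could have 2r + 1 points,
-- but then G itself (ℓ = 1) has growth at most 2.
module Submission where

open import Data.Bool.Base using (Bool; true; false)
open import Data.Fin.Base as Fin using (Fin; zero; suc; toℕ; inject₁; fromℕ<)
import Data.Fin.Properties as Fin
open import Data.Fin.Subset using (Subset; _∈_; ∣_∣; Nonempty; inside; outside; ⊥; ⁅_⁆; _∪_)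
open import Data.Fin.Subset.Properties
  using (_∈?_; nonempty?; ∣⊥∣≡0; ∣⁅x⁆∣≡1; ∣p∣≤n; p⊆q⇒∣p∣≤∣q∣; x∈⁅x⁆; x∈p∪q⁺)
open import Data.Integer.Base using (+_)
import Data.Integer.Base as ℤ
import Data.Integer.Properties as ℤ
open import Data.List.Base as List using (List; []; _∷_; _++_; length)
open import Data.List.Extrema.Nat using (xs≤max)
open import Data.List.Membership.Propositional using () renaming (_∈_ to _∈ˡ_)
open import Data.List.Membership.Propositional.Properties
  using (∈-map⁺; ∈-allFin; ∈-∃++; ∈-++⁺ˡ; ∈-++⁺ʳ)
open import Data.List.Properties using (length-map; length-++)
open import Data.List.Relation.Binary.Permutation.Propositional using (_↭_)
open import Data.List.Relation.Binary.Permutation.Propositional.Properties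
  using (shift; ∈-resp-↭; ↭-length)
import Data.List.Relation.Unary.All as All
open import Data.List.Relation.Unary.Any using (here; there)
open import Data.Nat.Base as ℕ
  using (ℕ; zero; suc; _+_; _*_; _∸_; _<_; NonZero; z≤n; s≤s; z<s; >-nonZero; >-nonZero⁻¹)
open import Data.Nat.Coprimality using (1-coprimeTo) renaming (sym to coprime-sym)
open import Data.Nat.Properties
open import Data.Product using (Σ; ∃; ∃₂; _×_; _,_; proj₁; proj₂)
open import Data.Product.Function.NonDependent.Propositional using (_×-↔_)
open import Data.Rational.Base as ℚ using (ℚ; mkℚ; *≤*)
import Data.Rational.Properties as ℚ
open import Data.Sum using (_⊎_; inj₁; inj₂; swap; [_,_]′)
open import Data.Sum.Function.Propositional using (_⊎-↔_)
open import Data.Sum.Properties using (inj₁-injective; inj₂-injective)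
open import Data.Vec.Base using ([]; _∷_; here; there; tabulate)
open import Data.Vec.Properties using ([]=⇒lookup; lookup⇒[]=; lookup∘tabulate)
open import Data.Vec.Properties.WithK using ([]=-irrelevant)
open import Function.Base using (_∘_)
open import Function.Bundles using (_↔_; mk↔ₛ′; Inverse)
open import Function.Construct.Composition using (_↔-∘_)
open import Function.Construct.Identity using (↔-id)
open import Relation.Binary.Definitions using (Tri; tri<; tri≈; tri>)
open import Relation.Binary.PropositionalEquality
open import Relation.Nullary using (Dec; yes; no; does; contradiction; ¬_; Irrelevant)
open import Relation.Nullary.Decidable using (map′; _×-dec_; _⊎-dec_; dec-true)
open import Relation.Unary using (Decidable)
open import Defs

open Graph

-- Natural numbers inside the rationals and the reals.

ℕ→ℚ-mkℚ : ∀ n → ℕ→ℚ n ≡ mkℚ (+ n) 0 (coprime-sym (1-coprimeTo n))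
ℕ→ℚ-mkℚ n = ℚ.normalize-coprime (coprime-sym (1-coprimeTo n))

ℕ→ℚ-mono-≤ : ∀ {m n} → m ℕ.≤ n → ℕ→ℚ m ℚ.≤ ℕ→ℚ n
ℕ→ℚ-mono-≤ {m} {n} m≤n rewrite ℕ→ℚ-mkℚ m | ℕ→ℚ-mkℚ n =
  *≤* (ℤ.*-monoʳ-≤-nonNeg (+ 1) (ℤ.+≤+ m≤n))

ℕ→ℚ-* : ∀ m n → ℕ→ℚ (m * n) ≡ ℕ→ℚ m ℚ.* ℕ→ℚ n
ℕ→ℚ-* m n rewrite ℕ→ℚ-mkℚ m | ℕ→ℚ-mkℚ n = cong (ℚ._/ 1) (ℤ.pos-* m n)

ℕ→ℝ-≤-trans : ∀ {m n} x → m ℕ.≤ n → ℕ→ℝ n ≤ x → ℕ→ℝ m ≤ x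
ℕ→ℝ-≤-trans x m≤n n≤x q<m = n≤x (ℚ.<-≤-trans q<m (ℕ→ℚ-mono-≤ m≤n))

-- For `q < M * n` the quotient `q / n` lies below `M`, hence in the lower cut of `x ÷ ℕ→ℚ n`.
-- Membership there is tested on `x` after multiplying back by `n`, which returns `q`.
ℕ→ℝ-≤-÷⇒*-≤ : ∀ {x} M n .{{_ : NonZero n}} → ℕ→ℝ M ≤ x ÷ ℕ→ℚ n → ℕ→ℝ (M * n) ≤ x
ℕ→ℝ-≤-÷⇒*-≤ {x} M n M≤x/n {q} q<Mn = subst (ℝ.lower x) q/n*n≡q (M≤x/n q/n<M)
  where
  instance
    _ = ℚ.pos⇒nonZero (ℕ→ℚ n)
    _ = ℚ.pos⇒nonNeg (ℕ→ℚ n)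
  q/n : ℚ
  q/n = q ℚ.* (ℚ.1/ ℕ→ℚ n)
  q/n*n≡q : q/n ℚ.* ℕ→ℚ n ≡ q
  q/n*n≡q = trans (ℚ.*-assoc q _ _) (trans (cong (q ℚ.*_) (ℚ.*-inverseˡ (ℕ→ℚ n))) (ℚ.*-identityʳ q))
  q/n<M : q/n ℚ.< ℕ→ℚ M
  q/n<M = ℚ.*-cancelʳ-<-nonNeg (ℕ→ℚ n) (subst₂ ℚ._<_ (sym q/n*n≡q) (ℕ→ℚ-* M n) q<Mn)

-- Finite types and the finiteness of the edge set.

Finite : Set → Set
Finite A = ∃ λ n → Fin n ↔ A

finite-Dec : ∀ {A} → Irrelevant A → Dec A → Finite A
finite-Dec irr (yes a) = 1 , mk↔ₛ′ (λ _ → a) (λ _ → zero) (irr a) λ { zero → refl }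
finite-Dec irr (no ¬a) = 0 , mk↔ₛ′ (λ ()) (λ a → contradiction a ¬a) (λ a → contradiction a ¬a) λ ()

finite-Σ : ∀ {n} {B : Fin n → Set} → (∀ i → Finite (B i)) → Finite (Σ (Fin n) B)
finite-Σ {zero}      fin = 0 , mk↔ₛ′ (λ ()) (λ ()) (λ ()) λ ()
finite-Σ {suc n} {B} fin =
  let m₀ , B₀↔ = fin zero
      m  , Bₛ↔ = finite-Σ (fin ∘ suc)
  in  m₀ + m , (unsplit ↔-∘ ((B₀↔ ⊎-↔ Bₛ↔) ↔-∘ Fin.+↔⊎))
  where
  unsplit : (B zero ⊎ Σ (Fin n) (B ∘ suc)) ↔ Σ (Fin (suc n)) B
  unsplit = mk↔ₛ′
    (λ { (inj₁ b) → zero , b ; (inj₂ (i , b)) → suc i , b })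
    (λ { (zero , b) → inj₁ b ; (suc i , b) → inj₂ (i , b) })
    (λ { (zero , b) → refl ; (suc i , b) → refl })
    (λ { (inj₁ b) → refl ; (inj₂ (i , b)) → refl })

module _ {A : Set} {n : ℕ} (A↔ : Fin n ↔ A) where
  open Inverse A↔

  finite-any? : {P : A → Set} → Decidable P → Dec (∃ P)
  finite-any? {P} P? = map′ (λ (i , p) → to i , p)
    (λ (a , p) → from a , subst P (sym (strictlyInverseˡ a)) p) (Fin.any? (P? ∘ to))

  from-injective : ∀ {a b} → from a ≡ from b → a ≡ b
  from-injective {a} {b} eq =
    trans (sym (strictlyInverseˡ a)) (trans (cong to eq) (strictlyInverseˡ b))

  finite-≟ : (a b : A) → Dec (a ≡ b)
  finite-≟ a b = map′ from-injective (cong from) (from a Fin.≟ from b)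

edge-≡ : ∀ G {e e′ : Edge G} → src G e ≡ src G e′ → tgt G e ≡ tgt G e′ → e ≡ e′
edge-≡ G {u , v , u<v , v∈u} {_ , _ , u<v′ , v∈u′} refl refl =
  cong₂ (λ p q → u , v , p , q) (Fin.<-irrelevant u<v u<v′) ([]=-irrelevant v∈u v∈u′)

-- For each pair of vertices the two conditions on an edge are decidable and have at most one proof,
-- so the pair contributes one edge or none.
edge-finite : ∀ G → Finite (Edge G)
edge-finite G = finite-Σ λ u → finite-Σ λ v → finite-Dec
  (λ (p , q) (p′ , q′) → cong₂ _,_ (Fin.<-irrelevant p p′) ([]=-irrelevant q q′))
  ((u Fin.<? v) ×-dec (v ∈? neighbours G u))

-- Counting subsets by lists.

members : ∀ {n} (p : Subset n) → List (∃ (_∈ p))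
members []            = []
members (inside  ∷ p) = (zero , here) ∷ List.map (λ (x , x∈p) → suc x , there x∈p) (members p)
members (outside ∷ p) = List.map (λ (x , x∈p) → suc x , there x∈p) (members p)

length-members : ∀ {n} (p : Subset n) → length (members p) ≡ ∣ p ∣
length-members []            = refl
length-members (inside  ∷ p) = cong suc (trans (length-map _ (members p)) (length-members p))
length-members (outside ∷ p) = trans (length-map _ (members p)) (length-members p)

∈-members : ∀ {n} (p : Subset n) {x} (x∈p : x ∈ p) → (x , x∈p) ∈ˡ members p
∈-members (inside  ∷ p) here        = here refl
∈-members (inside  ∷ p) (there x∈p) = there (∈-map⁺ _ (∈-members p x∈p))
∈-members (outside ∷ p) (there x∈p) = ∈-map⁺ _ (∈-members p x∈p)

∣p∪q∣≤∣p∣+∣q∣ : ∀ {n} (p q : Subset n) → ∣ p ∪ q ∣ ℕ.≤ ∣ p ∣ + ∣ q ∣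
∣p∪q∣≤∣p∣+∣q∣ []            []            = z≤n
∣p∪q∣≤∣p∣+∣q∣ (outside ∷ p) (outside ∷ q) = ∣p∪q∣≤∣p∣+∣q∣ p q
∣p∪q∣≤∣p∣+∣q∣ (inside  ∷ p) (outside ∷ q) = s≤s (∣p∪q∣≤∣p∣+∣q∣ p q)
∣p∪q∣≤∣p∣+∣q∣ (outside ∷ p) (inside  ∷ q) =
  ≤-trans (s≤s (∣p∪q∣≤∣p∣+∣q∣ p q)) (≤-reflexive (sym (+-suc ∣ p ∣ ∣ q ∣)))
∣p∪q∣≤∣p∣+∣q∣ (inside  ∷ p) (inside  ∷ q) =
  s≤s (≤-trans (∣p∪q∣≤∣p∣+∣q∣ p q) (+-monoʳ-≤ ∣ p ∣ (n≤1+n ∣ q ∣)))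

-- The list is turned into a union of singletons; repeated entries can only make the union smaller.
⊆-list⇒∣p∣≤length : ∀ {n} (p : Subset n) xs → (∀ {x} → x ∈ p → x ∈ˡ xs) → ∣ p ∣ ℕ.≤ length xs
⊆-list⇒∣p∣≤length {n} p xs p⊆xs = ≤-trans (p⊆q⇒∣p∣≤∣q∣ (∈-fromList xs ∘ p⊆xs)) (∣fromList∣≤length xs)
  where
  fromList : List (Fin n) → Subset n
  fromList = List.foldr (λ x q → ⁅ x ⁆ ∪ q) ⊥
  ∈-fromList : ∀ xs {x} → x ∈ˡ xs → x ∈ fromList xs
  ∈-fromList (y ∷ xs) (here refl) = x∈p∪q⁺ (inj₁ (x∈⁅x⁆ y))
  ∈-fromList (y ∷ xs) (there x∈)  = x∈p∪q⁺ (inj₂ (∈-fromList xs x∈))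
  ∣fromList∣≤length : ∀ xs → ∣ fromList xs ∣ ℕ.≤ length xs
  ∣fromList∣≤length []       = ≤-reflexive (∣⊥∣≡0 n)
  ∣fromList∣≤length (y ∷ xs) = ≤-trans (∣p∪q∣≤∣p∣+∣q∣ ⁅ y ⁆ (fromList xs))
    (+-mono-≤ (≤-reflexive (∣⁅x⁆∣≡1 y)) (∣fromList∣≤length xs))

-- Bounds on degree and growth.

degree≤maxDegree : ∀ G v → degree G v ℕ.≤ maxDegree G
degree≤maxDegree G v = All.lookup (xs≤max 0 _) (∈-map⁺ (degree G) (∈-allFin v))

growth≤order : ∀ G r → growth G r ℕ.≤ order G
growth≤order G r with growth-attained G r
... | inj₁ eq              = ≤-trans (≤-reflexive eq) z≤n
... | inj₂ (H , _ , _ , eq) = ≤-trans (≤-reflexive eq) (∣p∣≤n (verts G H))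

-- `Near k` is an invariant containing the ball of radius `k` about `c`. It may be larger than the
-- ball: only closure under a step is asked, so no distance has to be computed. The list may contain
-- repetitions.
record BallCover {V : Set} (_∼_ : V → V → Set) (r B : ℕ) (c : V) : Set₁ where
  field
    Near         : ℕ → V → Set
    near-0       : Near 0 c
    near-suc     : ∀ {k x y} → k < r → Near k x → x ∼ y → Near (suc k) y
    cover        : List V
    ∈-cover      : ∀ {k x} → k ℕ.≤ r → Near k x → x ∈ˡ cover
    length-cover : length cover ℕ.≤ B

module _ (G : Graph) where

  Adjacent : Vertex G → Vertex G → Set
  Adjacent x y = y ∈ neighbours G x

  -- A subgraph attaining the growth has a centre `c` from which each of its vertices is reached by
  -- a walk of length at most `r`. Its edges are edges of `G`, so the walk stays within `Near`, and
  -- the vertex is on the list for `c`.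
  growth≤cover : ∀ {r B} → (∀ c → BallCover Adjacent r B c) → growth G r ℕ.≤ B
  growth≤cover {r} covers with growth-attained G r
  ... | inj₁ eq = ≤-trans (≤-reflexive eq) z≤n
  ... | inj₂ (H , sub , (c , _ , ecc) , eq) =
    ≤-trans (≤-reflexive eq) (≤-trans (⊆-list⇒∣p∣≤length (verts G H) cover v∈⇒v∈cover) length-cover)
    where
    open BallCover (covers c)
    near-walk : ∀ {j k x y} → j + k ℕ.≤ r → Near j x → Walk G H k x y → Near (j + k) y
    near-walk {j} {zero}  _  near refl rewrite +-identityʳ j = near
    near-walk {j} {suc k} le near (w , w∈ , walk) rewrite +-suc j k =
      let _ , _ , x∼w , _ = sub _ _ w∈
      in  near-walk le (near-suc (≤-trans (s≤s (m≤m+n j k)) le) near x∼w) walk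
    v∈⇒v∈cover : ∀ {v} → v ∈ verts G H → v ∈ˡ cover
    v∈⇒v∈cover v∈ = let k , k≤r , walk = ecc _ v∈ in ∈-cover k≤r (near-walk k≤r near-0 walk)

-- Graphs from decidable relations on finite types.

does≡true⇒ : ∀ {A : Set} (a? : Dec A) → does a? ≡ true → A
does≡true⇒ (yes a) _ = a

module FromRelation {V : Set} {n} (V↔ : Fin n ↔ V) {_∼_ : V → V → Set} (_∼?_ : ∀ x y → Dec (x ∼ y))
  (∼-sym : ∀ {x y} → x ∼ y → y ∼ x) (∼-irrefl : ∀ {x} → ¬ (x ∼ x)) where
  open Inverse V↔

  row : Fin n → Subset n
  row x = tabulate λ y → does (to x ∼? to y)

  ∈-row⁻ : ∀ {x y} → y ∈ row x → to x ∼ to y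
  ∈-row⁻ {x} {y} y∈ =
    does≡true⇒ (to x ∼? to y) (trans (sym (lookup∘tabulate _ y)) ([]=⇒lookup y∈))

  ∈-row⁺ : ∀ {x y} → to x ∼ to y → y ∈ row x
  ∈-row⁺ {x} {y} x∼y = lookup⇒[]= y (row x) (trans (lookup∘tabulate _ y) (dec-true (to x ∼? to y) x∼y))

  graph : Graph
  graph = record
    { order             = n
    ; neighbours        = row
    ; neighbours-sym    = ∈-row⁺ ∘ ∼-sym ∘ ∈-row⁻
    ; neighbours-irrefl = ∼-irrefl ∘ ∈-row⁻
    }

  graph-cover : ∀ {r B c} → BallCover _∼_ r B (to c) → BallCover (Adjacent graph) r B c
  graph-cover C = record
    { Near         = λ k → Near k ∘ to
    ; near-0       = near-0
    ; near-suc     = λ k<r near y∈ → near-suc k<r near (∈-row⁻ y∈)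
    ; cover        = List.map from cover
    ; ∈-cover      = λ k≤r near → subst (_∈ˡ _) (strictlyInverseʳ _) (∈-map⁺ from (∈-cover k≤r near))
    ; length-cover = ≤-trans (≤-reflexive (length-map from cover)) length-cover
    }
    where open BallCover C

-- The subdivision of each edge into a path of ℓ edges.

module UniformSubdivision (G : Graph) (k : ℕ) where

  ℓ : ℕ
  ℓ = suc k

  -- A branch vertex or one of the `k` points inserted into an edge. Since `Fin k` counts from 0,
  -- `(e , j)` has index `j + 1` on the path of `e`.
  Point : Set
  Point = Vertex G ⊎ (Edge G × Fin k)

  m : ℕ
  m = proj₁ (edge-finite G)

  abstract
    point↔ : Fin (order G + m * k) ↔ Point
    point↔ = (↔-id _ ⊎-↔ ((proj₂ (edge-finite G) ×-↔ ↔-id _) ↔-∘ Fin.*↔×)) ↔-∘ Fin.+↔⊎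

  open Inverse point↔

  pointAt : Edge G → ∀ i → Dec (i < k) → Point
  pointAt e i (yes i<k) = inj₂ (e , fromℕ< i<k)
  pointAt e i (no _)    = inj₁ (tgt G e)

  -- Every index from ℓ on denotes the target of e.
  at : Edge G → ℕ → Point
  at e zero    = inj₁ (src G e)
  at e (suc i) = pointAt e i (i <? k)

  at-ℓ : ∀ e → at e ℓ ≡ inj₁ (tgt G e)
  at-ℓ e with k <? k
  ... | yes k<k = contradiction k<k (<-irrefl refl)
  ... | no _    = refl

  at-inner : ∀ e j → at e (suc (toℕ j)) ≡ inj₂ (e , j)
  at-inner e j with toℕ j <? k
  ... | yes j<k = cong (λ j → inj₂ (e , j)) (Fin.fromℕ<-toℕ j j<k)
  ... | no j≮k  = contradiction (Fin.toℕ<n j) j≮k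

  data Position : ℕ → Set where
    first : Position 0
    inner : ∀ (j : Fin k) → Position (suc (toℕ j))
    last  : Position ℓ

  position : ∀ {i} → i ℕ.≤ ℓ → Position i
  position {zero}  _ = first
  position {suc i} (s≤s i≤k) with m≤n⇒m<n∨m≡n i≤k
  ... | inj₁ i<k  = subst (Position ∘ suc) (Fin.toℕ-fromℕ< i<k) (inner (fromℕ< i<k))
  ... | inj₂ refl = last

  src≢tgt : ∀ e → src G e ≢ tgt G e
  src≢tgt (_ , _ , u<v , _) u≡v = Fin.<-irrefl u≡v u<v

  at≡branch : ∀ e {i u} → i ℕ.≤ ℓ → at e i ≡ inj₁ u →
    (i ≡ 0 × src G e ≡ u) ⊎ (i ≡ ℓ × tgt G e ≡ u)
  at≡branch e i≤ℓ eq with position i≤ℓ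
  ... | first   = inj₁ (refl , inj₁-injective eq)
  ... | inner j = contradiction (trans (sym (at-inner e j)) eq) λ ()
  ... | last    = inj₂ (refl , inj₁-injective (trans (sym (at-ℓ e)) eq))

  at≡inner : ∀ e {i e′ j} → i ℕ.≤ ℓ → at e i ≡ inj₂ (e′ , j) → e ≡ e′ × i ≡ suc (toℕ j)
  at≡inner e i≤ℓ eq with position i≤ℓ
  ... | first   = contradiction eq λ ()
  ... | last    = contradiction (trans (sym eq) (at-ℓ e)) λ ()
  ... | inner j with trans (sym (at-inner e j)) eq
  ...   | refl = refl , refl

  -- An inner point determines its index, and the two ends are distinct because an edge has `u < v`.
  at-injective : ∀ e {i j} → i ℕ.≤ ℓ → j ℕ.≤ ℓ → at e i ≡ at e j → i ≡ j
  at-injective e {i} i≤ℓ j≤ℓ eq with position j≤ℓ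
  ... | inner j = proj₂ (at≡inner e i≤ℓ (trans eq (at-inner e j)))
  ... | first with at≡branch e i≤ℓ eq
  ...   | inj₁ (i≡0 , _)    = i≡0
  ...   | inj₂ (_ , t≡s)    = contradiction (sym t≡s) (src≢tgt e)
  at-injective e {i} i≤ℓ j≤ℓ eq | last with at≡branch e i≤ℓ (trans eq (at-ℓ e))
  ...   | inj₁ (_ , s≡t)    = contradiction s≡t (src≢tgt e)
  ...   | inj₂ (i≡ℓ , _)    = i≡ℓ

  Link : Edge G → Fin ℓ → Point → Point → Set
  Link e i x y = at e (toℕ i) ≡ x × at e (suc (toℕ i)) ≡ y

  _∼_ : Point → Point → Set
  x ∼ y = ∃₂ λ e i → Link e i x y ⊎ Link e i y x

  _∼?_ : ∀ x y → Dec (x ∼ y)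
  x ∼? y = finite-any? (proj₂ (edge-finite G)) λ e → Fin.any? λ i → link? e i x y ⊎-dec link? e i y x
    where
    link? : ∀ e i x y → Dec (Link e i x y)
    link? e i x y = finite-≟ point↔ _ _ ×-dec finite-≟ point↔ _ _

  ∼-sym : ∀ {x y} → x ∼ y → y ∼ x
  ∼-sym (e , i , inj₁ l) = e , i , inj₂ l
  ∼-sym (e , i , inj₂ l) = e , i , inj₁ l

  link-irrefl : ∀ e i {x} → ¬ Link e i x x
  link-irrefl e i (p , q) =
    1+n≢n (at-injective e (Fin.toℕ<n i) (<⇒≤ (Fin.toℕ<n i)) (trans q (sym p)))

  ∼-irrefl : ∀ {x} → ¬ (x ∼ x)
  ∼-irrefl (e , i , inj₁ l) = link-irrefl e i l
  ∼-irrefl (e , i , inj₂ l) = link-irrefl e i l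

  open FromRelation point↔ _∼?_ ∼-sym ∼-irrefl public

  fin≤ℓ : (i : Fin (suc ℓ)) → toℕ i ℕ.≤ ℓ
  fin≤ℓ i = ≤-pred (Fin.toℕ<n i)

  edgePath : ∀ e → Path graph (from (inj₁ (src G e))) (from (inj₁ (tgt G e)))
  edgePath e = record
    { length    = ℓ
    ; at        = from ∘ at e ∘ toℕ
    ; start     = refl
    ; end       = cong from (trans (cong (at e) (Fin.toℕ-fromℕ ℓ)) (at-ℓ e))
    ; adjacent  = λ i → ∈-row⁺ (e , i , inj₁
        ( sym (trans (strictlyInverseˡ _) (cong (at e) (Fin.toℕ-inject₁ i)))
        , sym (strictlyInverseˡ _)))
    ; injective = λ {i} {j} eq → Fin.toℕ-injective
        (at-injective e (fin≤ℓ i) (fin≤ℓ j) (from-injective point↔ eq))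
    }

  open Path using (Interior)

  interior⇒inner : ∀ e {x} → Interior (edgePath e) x → ∃ λ j → x ≡ from (inj₂ (e , j))
  interior⇒inner e (i , i≢0 , i≢ℓ , refl) with toℕ i in eq | position (fin≤ℓ i)
  ... | _ | first   = contradiction (Fin.toℕ-injective eq) i≢0
  ... | _ | last    = contradiction (Fin.toℕ-injective (trans eq (sym (Fin.toℕ-fromℕ ℓ)))) i≢ℓ
  ... | _ | inner j = j , cong from (at-inner e j)

  inner⇒interior : ∀ e j → Interior (edgePath e) (from (inj₂ (e , j)))
  inner⇒interior e j = suc (inject₁ j) , (λ ())
    , (λ eq → Fin.fromℕ≢inject₁ (sym (Fin.suc-injective eq)))
    , cong from (trans (cong (at e ∘ suc) (Fin.toℕ-inject₁ j)) (at-inner e j))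

  subdivision : Subdivision G graph
  subdivision = record
    { branch           = from ∘ inj₁
    ; branch-injective = inj₁-injective ∘ from-injective point↔
    ; path             = edgePath
    ; interior-branch  = λ e x∈ v x≡v → let _ , x≡ = interior⇒inner e x∈ in
        contradiction (from-injective point↔ (trans (sym x≡) x≡v)) λ ()
    ; interior-path    = λ e e′ x∈ x∈′ →
        let _ , x≡  = interior⇒inner e x∈
            _ , x≡′ = interior⇒inner e′ x∈′
            e≡e′    = cong proj₁ (inj₂-injective (from-injective point↔ (trans (sym x≡) x≡′)))
        in  cong (src G) e≡e′ , cong (tgt G) e≡e′
    ; vertices-covered = covered
    ; edges-covered    = λ y∈ → let e , i , l = ∈-row⁻ y∈ in e , i , traverse e i l
    }
    where
    covered : ∀ x → (∃ λ v → x ≡ from (inj₁ v)) ⊎ (∃ λ e → Interior (edgePath e) x)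
    covered x with to x in eq
    ... | inj₁ v       = inj₁ (v , trans (sym (strictlyInverseʳ x)) (cong from eq))
    ... | inj₂ (e , j) = inj₂ (e , subst (Interior (edgePath e))
      (trans (sym (cong from eq)) (strictlyInverseʳ x)) (inner⇒interior e j))
    step : ∀ e i {x y} → Link e i (to x) (to y) →
      from (at e (toℕ (inject₁ i))) ≡ x × from (at e (suc (toℕ i))) ≡ y
    step e i (p , q) =
        trans (cong from (trans (cong (at e) (Fin.toℕ-inject₁ i)) p)) (strictlyInverseʳ _)
      , trans (cong from q) (strictlyInverseʳ _)
    traverse : ∀ e i {x y} → Link e i (to x) (to y) ⊎ Link e i (to y) (to x) →
      (from (at e (toℕ (inject₁ i))) ≡ x × from (at e (suc (toℕ i))) ≡ y) ⊎
      (from (at e (toℕ (inject₁ i))) ≡ y × from (at e (suc (toℕ i))) ≡ x)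
    traverse e i (inj₁ l) = inj₁ (step e i l)
    traverse e i (inj₂ l) = inj₂ (step e i l)

  -- Darts, that is, edges with a direction.

  Dart : Set
  Dart = Edge G × Bool

  origin : Dart → Vertex G
  origin (e , false) = src G e
  origin (e , true)  = tgt G e

  -- Measuring from either end of an edge allows a point to be placed in the first half of a dart.
  -- Beyond ℓ, truncated subtraction keeps a reversed dart at its end, as `at` does for a forward
  -- one.
  pos : Dart → ℕ → Point
  pos (e , false) t = at e t
  pos (e , true)  t = at e (ℓ ∸ t)

  pos-0 : ∀ a → pos a 0 ≡ inj₁ (origin a)
  pos-0 (e , false) = refl
  pos-0 (e , true)  = at-ℓ e

  -- An `Edge` stores its smaller endpoint first, so comparing `u` with `w` tells whether the dart
  -- runs along the edge or against it.
  orient : ∀ {u w} → w ∈ neighbours G u → Tri (u Fin.< w) (u ≡ w) (w Fin.< u) → Dart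
  orient w∈ (tri< u<w _ _)  = (_ , _ , u<w , w∈) , false
  orient w∈ (tri≈ _ refl _) = contradiction w∈ (neighbours-irrefl G)
  orient w∈ (tri> _ _ w<u)  = (_ , _ , w<u , neighbours-sym G w∈) , true

  origin-orient : ∀ {u w} (w∈ : w ∈ neighbours G u) c → origin (orient w∈ c) ≡ u
  origin-orient w∈ (tri< _ _ _)    = refl
  origin-orient w∈ (tri≈ _ refl _) = contradiction w∈ (neighbours-irrefl G)
  origin-orient w∈ (tri> _ _ _)    = refl

  end : Dart → Vertex G
  end (e , false) = tgt G e
  end (e , true)  = src G e

  end∈ : ∀ a → end a ∈ neighbours G (origin a)
  end∈ ((_ , _ , _ , v∈) , false) = v∈
  end∈ ((_ , _ , _ , v∈) , true)  = neighbours-sym G v∈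

  -- This makes `darts` exhaustive: a dart is recovered from its end as a neighbour of its origin.
  -- Any comparison `c` will do, as `u < v` excludes all outcomes but one.
  orient-end∈ : ∀ a c → orient (end∈ a) c ≡ a
  orient-end∈ (e@(_ , _ , u<v , _) , false) (tri< _ _ _)   = cong (_, false) (edge-≡ G refl refl)
  orient-end∈ (e@(_ , _ , u<v , _) , false) (tri≈ u≮v _ _) = contradiction u<v u≮v
  orient-end∈ (e@(_ , _ , u<v , _) , false) (tri> u≮v _ _) = contradiction u<v u≮v
  orient-end∈ (e@(_ , _ , u<v , _) , true)  (tri< _ _ u≯v) = contradiction u<v u≯v
  orient-end∈ (e@(_ , _ , u<v , _) , true)  (tri≈ _ _ u≯v) = contradiction u<v u≯v
  orient-end∈ (e@(_ , _ , u<v , _) , true)  (tri> _ _ _)   = cong (_, true) (edge-≡ G refl refl)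

  darts : Vertex G → List Dart
  -- The adjacency proofs kept by `members` become components of the edges.
  darts u = List.map (λ (w , w∈) → orient w∈ (Fin.<-cmp u w)) (members (neighbours G u))

  length-darts : ∀ u → length (darts u) ≡ degree G u
  length-darts u = trans (length-map _ (members (neighbours G u))) (length-members (neighbours G u))

  ∈-darts : ∀ a → a ∈ˡ darts (origin a)
  ∈-darts a = subst (_∈ˡ darts (origin a)) (orient-end∈ a (Fin.<-cmp (origin a) (end a)))
    (∈-map⁺ (λ (w , w∈) → orient w∈ (Fin.<-cmp (origin a) w))
      (∈-members (neighbours G (origin a)) (end∈ a)))

  -- A branch vertex occurs on a path only at index 0 or ℓ. A link there is the first step of the
  -- forward or of the reversed dart.
  branch-step : ∀ {u y} → inj₁ u ∼ y → ∃ λ a → origin a ≡ u × y ≡ pos a 1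
  branch-step (e , i , inj₁ (p , q)) with at≡branch e (<⇒≤ (Fin.toℕ<n i)) p
  ... | inj₁ (i≡0 , s≡u) = (e , false) , s≡u , trans (sym q) (cong (at e ∘ suc) i≡0)
  ... | inj₂ (i≡ℓ , _)   = contradiction i≡ℓ (<⇒≢ (Fin.toℕ<n i))
  branch-step (e , i , inj₂ (q , p)) with at≡branch e (Fin.toℕ<n i) p
  ... | inj₂ (1+i≡ℓ , t≡u) = (e , true) , t≡u , trans (sym q) (cong (at e) (suc-injective 1+i≡ℓ))

  -- An inner point lies on one path only and at one index, so just the two links at that index meet
  -- it.
  at-step : ∀ e {p y} → p < k → at e (suc p) ∼ y → y ≡ at e p ⊎ y ≡ at e (suc (suc p))
  at-step e {p} {y} p<k (e′ , i , l) = go l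
    where
    at-p : at e (suc p) ≡ inj₂ (e , fromℕ< p<k)
    at-p = trans (cong (at e ∘ suc) (sym (Fin.toℕ-fromℕ< p<k))) (at-inner e (fromℕ< p<k))
    go : Link e′ i (at e (suc p)) y ⊎ Link e′ i y (at e (suc p)) → y ≡ at e p ⊎ y ≡ at e (suc (suc p))
    go (inj₁ (eq , q)) with at≡inner e′ (<⇒≤ (Fin.toℕ<n i)) (trans eq at-p)
    ... | refl , i≡ = inj₂ (trans (sym q) (cong (at e ∘ suc) (trans i≡ (cong suc (Fin.toℕ-fromℕ< p<k)))))
    go (inj₂ (q , eq)) with at≡inner e′ (Fin.toℕ<n i) (trans eq at-p)
    ... | refl , i≡ = inj₁ (trans (sym q) (cong (at e) (trans (suc-injective i≡) (Fin.toℕ-fromℕ< p<k))))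

  dart-step : ∀ a {t y} → suc t < ℓ → pos a (suc t) ∼ y → y ≡ pos a t ⊎ y ≡ pos a (suc (suc t))
  dart-step (e , false)     (s≤s t<k) x∼y = at-step e t<k x∼y
  -- The index `k ∸ t` is rewritten as `suc (k ∸ suc t)` to apply `at-step`. Indices descend along a
  -- reversed dart, so the two outcomes are swapped.
  dart-step (e , true) {t} {y} (s≤s t<k) x∼y = swap (subst (λ p → y ≡ at e (k ∸ suc t) ⊎ y ≡ at e p)
    (trans (cong suc (sym (+-∸-assoc 1 t<k))) (sym (+-∸-assoc 1 (<⇒≤ t<k))))
    (at-step e (∸-monoʳ-< {k} z<s t<k) (subst (λ p → at e p ∼ y) (+-∸-assoc 1 t<k) x∼y)))

  -- The ball about a point in the first half of a dart.

  module _ (a : Dart) (others : List Dart)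
    (∈-others : ∀ b → origin b ≡ origin a → b ∈ˡ a ∷ others)
    {d r Δ : ℕ} (d+d≤ℓ : d + d ℕ.≤ ℓ) (r+r<ℓ : r + r < ℓ)
    (2≤Δ : 2 ℕ.≤ Δ) (1+∣others∣≤Δ : suc (length others) ℕ.≤ Δ) where

    -- Within distance k < ℓ / 2 of pos a d one does not pass beyond the origin of a, except
    -- along another dart out of it.
    data Near (k : ℕ) : Point → Set where
      along : ∀ {t} → t ℕ.≤ k + d → d ℕ.≤ k + t → Near k (pos a t)
      off   : ∀ b {t} → origin b ≡ origin a → t + d ℕ.≤ k → Near k (pos b t)

    -- All darts `b` out of the origin share the point `pos b 0`. The next step may be along `a`
    -- again: `off` permits this, and `off∈layers` sorts it out.
    near-origin : ∀ b {k y} → origin b ≡ origin a → d ℕ.≤ k → pos b 0 ∼ y → Near (suc k) y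
    near-origin b b≡ d≤k x∼y with branch-step (subst (_∼ _) (pos-0 b) x∼y)
    ... | b′ , b′≡ , refl = off b′ (trans b′≡ b≡) (s≤s d≤k)

    -- Twice the larger of `r` and `d` is at most ℓ. Hence the ball does not pass the far end of
    -- `a`.
    r+d≤ℓ : r + d ℕ.≤ ℓ
    r+d≤ℓ with ≤-total d r
    ... | inj₁ d≤r = <⇒≤ (≤-<-trans (+-monoʳ-≤ r d≤r) r+r<ℓ)
    ... | inj₂ r≤d = ≤-trans (+-monoˡ-≤ d r≤d) d+d≤ℓ

    near-step : ∀ {k x y} → k < r → Near k x → x ∼ y → Near (suc k) y
    near-step {k} k<r (along {zero} _ d≤k) x∼y =
      near-origin a refl (subst (d ℕ.≤_) (+-identityʳ k) d≤k) x∼y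
    -- Here `suc t ≤ k + d < r + d ≤ ℓ`, so the point is interior to `a` and has only two
    -- neighbours.
    near-step {k} k<r (along {suc t} t<k+d d≤k+1+t) x∼y
      with dart-step a (≤-<-trans t<k+d (<-≤-trans (+-monoˡ-< d k<r) r+d≤ℓ)) x∼y
    ... | inj₁ refl = along (m≤n⇒m≤1+n (<⇒≤ t<k+d)) (subst (d ℕ.≤_) (+-suc k t) d≤k+1+t)
    ... | inj₂ refl = along (s≤s t<k+d) (≤-trans d≤k+1+t (+-mono-≤ (n≤1+n k) (n≤1+n (suc t))))
    near-step k<r (off b {zero}  b≡ d≤k) x∼y = near-origin b b≡ d≤k x∼y
    -- Likewise `suc t ≤ k < r ≤ ℓ`, so the point is interior to `b`.
    near-step k<r (off b {suc t} b≡ t+d<k) x∼y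
      with dart-step b (≤-<-trans (≤-trans (m≤m+n _ d) t+d<k)
             (<-≤-trans k<r (≤-trans (m≤m+n r r) (<⇒≤ r+r<ℓ)))) x∼y
    ... | inj₁ refl = off b b≡ (m≤n⇒m≤1+n (<⇒≤ t+d<k))
    ... | inj₂ refl = off b b≡ (s≤s t+d<k)

    -- The points at distance `j` from the centre in the direction of the origin: a single one on
    -- `a` until the origin is reached, then one on each other dart.
    inward : ∀ j → Dec (j ℕ.≤ d) → List Point
    inward j (yes _) = pos a (d ∸ j) ∷ []
    inward j (no _)  = List.map (λ b → pos b (j ∸ d)) others

    layer : ℕ → List Point
    layer j = pos a (d + j) ∷ inward j (j ≤? d)

    -- Up to the origin a layer lists two points, whence `2≤Δ`. Past it, one point is listed for `a`
    -- and one for each of `others`.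
    length-layer : ∀ j → length (layer j) ℕ.≤ Δ
    length-layer j with j ≤? d
    ... | yes _ = 2≤Δ
    ... | no _  = ≤-trans (≤-reflexive (cong suc (length-map _ others))) 1+∣others∣≤Δ

    -- The centre is listed by itself, since `layer 0` would list it twice and exceed the bound
    -- `Δ * 0 + 1`.
    layers : ℕ → List Point
    layers zero    = pos a d ∷ []
    layers (suc j) = layer (suc j) ++ layers j

    length-layers : ∀ j → length (layers j) ℕ.≤ Δ * j + 1
    length-layers zero    = m≤n+m 1 (Δ * 0)
    length-layers (suc j) = begin
      length (layer (suc j) ++ layers j)         ≡⟨ length-++ (layer (suc j)) ⟩
      length (layer (suc j)) + length (layers j) ≤⟨ +-mono-≤ (length-layer (suc j)) (length-layers j) ⟩
      Δ + (Δ * j + 1)                            ≡⟨ +-assoc Δ (Δ * j) 1 ⟨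
      Δ + Δ * j + 1                              ≡⟨ cong (_+ 1) (*-suc Δ j) ⟨
      Δ * suc j + 1                              ∎
      where open ≤-Reasoning

    centre∈layers : ∀ j → pos a d ∈ˡ layers j
    centre∈layers zero    = here refl
    centre∈layers (suc j) = ∈-++⁺ʳ (layer (suc j)) (centre∈layers j)

    layer⊆layers : ∀ {j s x} → 0 < j → j ℕ.≤ s → x ∈ˡ layer j → x ∈ˡ layers s
    layer⊆layers {s = zero}  z<s () _
    layer⊆layers {s = suc s} 0<j j≤1+s x∈ with m≤n⇒m<n∨m≡n j≤1+s
    ... | inj₁ (s≤s j≤s) = ∈-++⁺ʳ (layer (suc s)) (layer⊆layers 0<j j≤s x∈)
    ... | inj₂ refl      = ∈-++⁺ˡ x∈

    -- For `t ≢ d` the point is in the layer whose index is the difference of `t` and `d`, ahead of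
    -- the centre or inward from it. The two hypotheses bound this index by `s`.
    along∈layers : ∀ {s t} → t ℕ.≤ s + d → d ℕ.≤ s + t → pos a t ∈ˡ layers s
    along∈layers {s} {t} t≤s+d d≤s+t with <-cmp t d
    ... | tri≈ _ refl _ = centre∈layers s
    ... | tri> _ _ d<t  = layer⊆layers (m<n⇒0<n∸m d<t)
      (m≤n+o⇒m∸n≤o t d (subst (t ℕ.≤_) (+-comm s d) t≤s+d))
      (here (cong (pos a) (sym (m+[n∸m]≡n (<⇒≤ d<t)))))
    ... | tri< t<d _ _  = layer⊆layers (m<n⇒0<n∸m t<d)
      (m≤n+o⇒m∸n≤o d t (subst (d ℕ.≤_) (+-comm s t) d≤s+t)) (there ∈-inward)
      where
      ∈-inward : pos a t ∈ˡ inward (d ∸ t) (d ∸ t ≤? d)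
      ∈-inward with d ∸ t ≤? d
      ... | yes _ = here (cong (pos a) (sym (m∸[m∸n]≡n (<⇒≤ t<d))))
      ... | no ≰d = contradiction (m∸n≤m d t) ≰d

    -- If `b` is `a`, the bound on `t + d` yields both bounds of `along`. At `t = 0` the point is
    -- the origin, which is `pos a 0`. Otherwise it is in layer `t + d`, beyond the origin.
    off∈layers : ∀ b {s t} → origin b ≡ origin a → t + d ℕ.≤ s → pos b t ∈ˡ layers s
    off∈layers b {s} {t} b≡ t+d≤s with ∈-others b b≡
    ... | here refl = along∈layers (≤-trans (m≤m+n t d) (≤-trans t+d≤s (m≤m+n s d)))
                                   (≤-trans (m≤n+m d t) (≤-trans t+d≤s (m≤m+n s t)))
    off∈layers b {s} {zero} b≡ d≤s | there _ =
      subst (_∈ˡ layers s) (trans (pos-0 a) (trans (cong inj₁ (sym b≡)) (sym (pos-0 b))))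
        (along∈layers z≤n (≤-trans d≤s (m≤m+n s 0)))
    off∈layers b {s} {suc t} b≡ t+d<s | there b∈ = layer⊆layers z<s t+d<s (there ∈-inward)
      where
      ∈-inward : pos b (suc t) ∈ˡ inward (suc t + d) (suc t + d ≤? d)
      ∈-inward with suc t + d ≤? d
      ... | yes ≤d = contradiction ≤d (m+1+n≰m d ∘ subst (ℕ._≤ d) (+-comm (suc t) d))
      ... | no _   = subst (λ i → pos b i ∈ˡ List.map (λ b → pos b (suc t + d ∸ d)) others)
        (m+n∸n≡m (suc t) d) (∈-map⁺ (λ b → pos b (suc t + d ∸ d)) b∈)

    dart-cover : BallCover _∼_ r (Δ * r + 1) (pos a d)
    dart-cover = record
      { Near         = Near
      ; near-0       = along ≤-refl ≤-refl
      ; near-suc     = near-step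
      ; cover        = layers r
      ; ∈-cover      = λ where
          k≤r (along t≤ d≤)  → along∈layers (≤-trans t≤ (+-monoˡ-≤ d k≤r)) (≤-trans d≤ (+-monoˡ-≤ _ k≤r))
          k≤r (off b b≡ t≤) → off∈layers b b≡ (≤-trans t≤ k≤r)
      ; length-cover = length-layers r
      }

  -- Covers for all centres and the growth of the subdivision.

  isolated-cover : ∀ {u r B} → ¬ Nonempty (neighbours G u) → 1 ℕ.≤ B → BallCover _∼_ r B (inj₁ u)
  isolated-cover {u} isolated 1≤B = record
    { Near         = λ _ → inj₁ u ≡_
    ; near-0       = refl
    ; near-suc     = λ { _ refl u∼y → let a , a≡u , _ = branch-step u∼y in
        contradiction (end a , subst (λ v → end a ∈ neighbours G v) a≡u (end∈ a)) isolated }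
    ; cover        = inj₁ u ∷ []
    ; ∈-cover      = λ { _ refl → here refl }
    ; length-cover = 1≤B
    }

  -- A vertex without neighbours is on no dart; every other point is in the first half of one.
  data Centre : Point → Set where
    isolated : ∀ {u} → ¬ Nonempty (neighbours G u) → Centre (inj₁ u)
    onDart   : ∀ a d → d + d ℕ.≤ ℓ → Centre (pos a d)

  centre : ∀ x → Centre x
  centre (inj₁ u) with nonempty? (neighbours G u)
  ... | no ¬w = isolated ¬w
  ... | yes (w , w∈) = let a = orient w∈ (Fin.<-cmp u w) in
    subst Centre (trans (pos-0 a) (cong inj₁ (origin-orient w∈ (Fin.<-cmp u w)))) (onDart a 0 z≤n)
  centre (inj₂ (e , j)) = subst Centre (at-inner e j) (go (≤-total (p + p) ℓ))
    where
    p : ℕ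
    p = suc (toℕ j)
    p≤ℓ : p ℕ.≤ ℓ
    p≤ℓ = s≤s (<⇒≤ (Fin.toℕ<n j))
    go : p + p ℕ.≤ ℓ ⊎ ℓ ℕ.≤ p + p → Centre (at e p)
    go (inj₁ p+p≤ℓ) = onDart (e , false) p p+p≤ℓ
    -- Past the middle, the reversed dart measures the point at `ℓ ∸ p`, which is at most half of ℓ.
    go (inj₂ ℓ≤p+p) = subst (Centre ∘ at e) (m∸[m∸n]≡n p≤ℓ) (onDart (e , true) (ℓ ∸ p)
      (≤-trans (+-monoʳ-≤ (ℓ ∸ p) (m≤n+o⇒m∸n≤o ℓ p ℓ≤p+p)) (≤-reflexive (m∸n+n≡m p≤ℓ))))

  module _ {r Δ} (2≤Δ : 2 ℕ.≤ Δ) (degree≤Δ : ∀ u → degree G u ℕ.≤ Δ) (r+r<ℓ : r + r < ℓ) where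

    point-cover : ∀ x → BallCover _∼_ r (Δ * r + 1) x
    point-cover x with centre x
    ... | isolated ¬w      = isolated-cover ¬w (m≤n+m 1 (Δ * r))
    ... | onDart a d d+d≤ℓ =
      -- Moving `a` to the front of the darts out of its origin leaves `ys ++ zs` as the others, one
      -- fewer than the degree.
      let ys , zs , eq = ∈-∃++ (∈-darts a)
          perm = subst (_↭ a ∷ (ys ++ zs)) (sym eq) (shift a ys zs)
      in  dart-cover a (ys ++ zs)
            (λ b b≡a → ∈-resp-↭ perm (subst (λ u → b ∈ˡ darts u) b≡a (∈-darts b)))
            d+d≤ℓ r+r<ℓ 2≤Δ
            (subst (ℕ._≤ Δ) (trans (sym (length-darts (origin a))) (↭-length perm))
              (degree≤Δ (origin a)))

    growth-small : growth graph r ℕ.≤ Δ * r + 1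
    growth-small = growth≤cover graph λ c → graph-cover (point-cover (to c))

  -- The whole order is used as a bound; `r + r` is positive, so it may also multiply `order G`. The
  -- resulting factor of `r` is independent of `k`.
  growth-large : ∀ {r} .{{_ : NonZero r}} → k ℕ.≤ r + r →
    growth graph r ℕ.≤ ((order G + m) + (order G + m)) * r
  growth-large {r} k≤r+r = begin
    growth graph r                        ≤⟨ growth≤order graph r ⟩
    order G + m * k                       ≤⟨ +-mono-≤ (m≤m*n (order G) (r + r)) (*-monoʳ-≤ m k≤r+r) ⟩
    order G * (r + r) + m * (r + r)       ≡⟨ *-distribʳ-+ (r + r) (order G) m ⟨
    (order G + m) * (r + r)               ≡⟨ *-distribˡ-+ (order G + m) r r ⟩
    (order G + m) * r + (order G + m) * r ≡⟨ *-distribʳ-+ r (order G + m) (order G + m) ⟨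
    ((order G + m) + (order G + m)) * r   ∎
    where
    open ≤-Reasoning
    instance
      _ = >-nonZero (≤-trans (>-nonZero⁻¹ r) (m≤m+n r r))

-- Graphs with all degrees at most one.

∣p∣≤1⇒unique : ∀ {n} {p : Subset n} {x y} → ∣ p ∣ ℕ.≤ 1 → x ∈ p → y ∈ p → x ≡ y
∣p∣≤1⇒unique {p = p} ∣p∣≤1 x∈p y∈p =
  cong proj₁ (unique (subst (ℕ._≤ 1) (sym (length-members p)) ∣p∣≤1) (∈-members p x∈p) (∈-members p y∈p))
  where
  unique : ∀ {A : Set} {xs : List A} {x y} → length xs ℕ.≤ 1 → x ∈ˡ xs → y ∈ˡ xs → x ≡ y
  unique {xs = _ ∷ []} _ (here refl) (here refl) = refl
  unique {xs = _ ∷ _ ∷ _} (s≤s ()) _ _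

module _ (G : Graph) (degree≤1 : ∀ u → degree G u ℕ.≤ 1) where
  open UniformSubdivision G 0

  pos-1 : ∀ a → pos a 1 ≡ inj₁ (end a)
  pos-1 (e , false) = refl
  pos-1 (e , true)  = refl

  branch-step₀ : ∀ {u y} → inj₁ u ∼ y → ∃ λ w → w ∈ neighbours G u × y ≡ inj₁ w
  branch-step₀ u∼y with branch-step u∼y
  ... | a , refl , refl = end a , end∈ a , pos-1 a

  -- The vertex `u` and its neighbours form a set closed under adjacency, which therefore serves for
  -- every radius.
  edge-cover : ∀ {r} x → BallCover _∼_ r 2 x
  edge-cover (inj₁ u) = record
    { Near         = λ _ y → y ≡ inj₁ u ⊎ ∃ λ w → w ∈ neighbours G u × y ≡ inj₁ w
    ; near-0       = inj₁ refl
    ; near-suc     = λ where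
        _ (inj₁ refl) u∼y → inj₂ (branch-step₀ u∼y)
        -- Both `u` and `v` are neighbours of `w`, which has only one.
        _ (inj₂ (w , w∈ , refl)) w∼y → let v , v∈ , y≡v = branch-step₀ w∼y in
          inj₁ (trans y≡v (cong inj₁ (∣p∣≤1⇒unique (degree≤1 w) v∈ (neighbours-sym G w∈))))
    ; cover        = inj₁ u ∷ List.map (inj₁ ∘ proj₁) (members (neighbours G u))
    ; ∈-cover      = λ where
        _ (inj₁ refl)            → here refl
        _ (inj₂ (w , w∈ , refl)) → there (∈-map⁺ (inj₁ ∘ proj₁) (∈-members (neighbours G u) w∈))
    ; length-cover = s≤s (≤-trans
        (≤-reflexive (trans (length-map _ (members (neighbours G u))) (length-members (neighbours G u))))
        (degree≤1 u))
    }

  growth≤2 : ∀ r → growth graph r ℕ.≤ 2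
  growth≤2 r = growth≤cover graph λ c → graph-cover (edge-cover (Inverse.to point↔ c))

-- The choice of ℓ and the bound by f.

BoundedSubdivision : ℕ⁺→ℝ → Graph → Set
BoundedSubdivision f G = ∃ λ G̃ → Σ (Subdivision G G̃) Subdivision.Uniform ×
  (∀ (r : ℕ) .{{_ : NonZero r}} → ℕ→ℝ (growth G̃ r) ≤ f r)

module _ (Δ : ℕ) (f : ℕ⁺→ℝ) (Δr+1≤f : ∀ (r : ℕ) .{{_ : NonZero r}} → ℕ→ℝ (Δ * r + 1) ≤ f r)
  (G : Graph) (degree≤Δ : ∀ u → degree G u ℕ.≤ Δ) where

  subdivide-Δ≤1 : .{{NonZero Δ}} → Δ ℕ.≤ 1 → BoundedSubdivision f G
  subdivide-Δ≤1 Δ≤1 = graph , (subdivision , λ _ _ → refl) , bound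
    where
    open UniformSubdivision G 0
    -- As `Δ` and `r` are positive, the linear lower bound on `f` leaves room for the two ends of an
    -- edge.
    2≤Δr+1 : ∀ r .{{_ : NonZero r}} → 2 ℕ.≤ Δ * r + 1
    2≤Δr+1 r = +-monoˡ-≤ 1 (>-nonZero⁻¹ (Δ * r) {{m*n≢0 Δ r}})
    bound : ∀ r .{{_ : NonZero r}} → ℕ→ℝ (growth graph r) ≤ f r
    bound r = ℕ→ℝ-≤-trans {growth graph r} {Δ * r + 1} (f r)
      (≤-trans (growth≤2 G (λ u → ≤-trans (degree≤Δ u) Δ≤1) r) (2≤Δr+1 r)) (Δr+1≤f r)

  subdivide-Δ>1 : Superlinear f → 1 < Δ → BoundedSubdivision f G
  subdivide-Δ>1 superlinear 1<Δ =
    graph , (subdivision , λ _ _ → refl) , λ r → bound r (<-≤-connex N r)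
    where
    M N : ℕ
    -- The factor from `growth-large`. It does not involve ℓ, so superlinearity can supply `N` first
    -- and ℓ can be chosen in terms of `N`.
    M = (order G + proj₁ (edge-finite G)) + (order G + proj₁ (edge-finite G))
    N = proj₁ (superlinear (ℕ→ℝ M))
    -- ℓ = 2 (N + 1), so that r ≤ N gives 2 r < ℓ and r > N gives ℓ ≤ 2 r.
    open UniformSubdivision G (N + suc N)
    bound : ∀ r .{{_ : NonZero r}} → N < r ⊎ r ℕ.≤ N → ℕ→ℝ (growth graph r) ≤ f r
    bound r (inj₁ N<r) = ℕ→ℝ-≤-trans {growth graph r} {M * r} (f r)
      (growth-large (<⇒≤ (+-mono-≤ N<r N<r)))
      (ℕ→ℝ-≤-÷⇒*-≤ {f r} M r (proj₂ (superlinear (ℕ→ℝ M)) r (<⇒≤ N<r)))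
    bound r (inj₂ r≤N) = ℕ→ℝ-≤-trans {growth graph r} {Δ * r + 1} (f r)
      (growth-small 1<Δ degree≤Δ (+-mono-≤ (s≤s r≤N) (≤-trans r≤N (n≤1+n N)))) (Δr+1≤f r)

theorem19 : (Δ : ℕ) .{{_ : NonZero Δ}} (f : ℕ⁺→ℝ) →
    Superlinear f →
    (∀ (r : ℕ) .{{_ : NonZero r}} → ℕ→ℝ (Δ * r + 1) ≤ f r) →
    (G : Graph) → maxDegree G ≡ Δ →
    ∃ λ (G̃ : Graph) → Σ (Subdivision G G̃) Subdivision.Uniform ×
    (∀ (r : ℕ) .{{_ : NonZero r}} → ℕ→ℝ (growth G̃ r) ≤ f r)
theorem19 Δ f superlinear Δr+1≤f G maxDegree≡Δ =
  [ subdivide-Δ≤1 Δ f Δr+1≤f G degree≤Δ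
  , subdivide-Δ>1 Δ f Δr+1≤f G degree≤Δ superlinear
  ]′ (≤-<-connex Δ 1)
  where
  degree≤Δ : ∀ u → degree G u ℕ.≤ Δ
  degree≤Δ u = subst (degree G u ℕ.≤_) maxDegree≡Δ (degree≤maxDegree G u)
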